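{- For integers $n\ge2$ and $0\le t\le n-1$, the number of $(102,110)$-avoiding inversion sequences $e$ of length $n$ with $\mathrm{rank}(e)=t$ is $$\binom{2n-t-2}{n-t-1}-\sum_{i=2}^{n-t}\binom{2n-t-2i}{n-t-i}.$$ (A sum whose upper limit is less than its lower limit is $0$.)
   Context: An inversion sequence of length $n$ is an integer sequence $e=(e_1,\dots,e_n)$ with $0\le e_j\le j-1$ for all $j$. It contains a pattern $w=w_1w_2w_3$ if there are indices $i_1<i_2<i_3$ such that $e_{i_1}e_{i_2}e_{i_3}$ is order-isomorphic to $w$ (same relations $<,=,>$ between corresponding pairs of entries); otherwise it avoids $w$. "$(w,w')$-avoiding" means avoiding both $w$ and $w'$. $\max(e)$ is the largest entry, and $\mathrm{fdes}(e)$ is the position $p$ of the first descent: $e_1\le\cdots\le e_p>e_{p+1}$, with the convention $e_{n+1}=-1$. For a $102$-avoiding $e$, $\mathrm{rank}(e):=\mathrm{fdes}(e)-\max(e)-1$. -}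

module Defs where

open import Data.Bool.Base using (if_then_else_)
open import Data.Fin.Base using (toℕ) renaming (_<_ to _<ᶠ_)
open import Data.Integer.Base as ℤ using (ℤ; +_)
open import Data.List.Base using (length; map; applyUpTo)
open import Data.List.Membership.Propositional using (_∈_)
open import Data.List.Relation.Unary.Unique.Propositional using (Unique)
open import Data.Nat.Base using (ℕ; suc; _+_; _∸_; _≤_; _<_; _⊔_)
open import Data.Nat.ListAction using (sum)
open import Data.Nat.Properties using (_≤?_)
open import Data.Product.Base using (_×_; ∃-syntax)
open import Data.Vec.Base using (Vec; []; _∷_; lookup; foldr′)
open import Function.Bundles using (_⇔_)
open import Relation.Binary.PropositionalEquality.Core using (_≡_)
open import Relation.Nullary.Decidable.Core using (does)
open import Relation.Nullary.Negation.Core using (¬_)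

-- Positions are 0-based, so e_j ≤ j - 1 reads `lookup e j ≤ toℕ j`.
IsInversionSequence : ∀ {n} → Vec ℕ n → Set
IsInversionSequence e = ∀ j → lookup e j ≤ toℕ j

-- The relation > is covered by exchanging a and b.
OrderIsomorphic : ∀ {k} → Vec ℕ k → Vec ℕ k → Set
OrderIsomorphic u w = ∀ a b →
  (lookup u a < lookup u b ⇔ lookup w a < lookup w b) ×
  (lookup u a ≡ lookup u b ⇔ lookup w a ≡ lookup w b)

Contains : ∀ {n} → Vec ℕ n → Vec ℕ 3 → Set
Contains e w = ∃[ i₁ ] ∃[ i₂ ] ∃[ i₃ ]
  i₁ <ᶠ i₂ × i₂ <ᶠ i₃ ×
  OrderIsomorphic (lookup e i₁ ∷ lookup e i₂ ∷ lookup e i₃ ∷ []) w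

Avoids : ∀ {n} → Vec ℕ n → Vec ℕ 3 → Set
Avoids e w = ¬ Contains e w

-- The entries are natural numbers, so starting the fold at 0 is harmless.
maxEntry : ∀ {n} → Vec ℕ n → ℕ
maxEntry = foldr′ _⊔_ 0

-- The 1-based position of the first descent.  The last entry always counts as
-- a descent (e_{n+1} = -1); the value on the empty sequence is a dummy.
fdes : ∀ {n} → Vec ℕ n → ℕ
fdes []           = 0
fdes (x ∷ [])     = 1
fdes (x ∷ y ∷ xs) = if does (x ≤? y) then suc (fdes (y ∷ xs)) else 1

rank : ∀ {n} → Vec ℕ n → ℤ
rank e = + fdes e ℤ.- + maxEntry e ℤ.- + 1

-- Exactly N elements of A satisfy P: some list without repetitions consists of
-- precisely these elements and has length N.
HasCount : {A : Set} → (A → Set) → ℕ → Set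
HasCount {A} P N = ∃[ xs ]
  Unique xs × (∀ (x : A) → x ∈ xs ⇔ P x) × length xs ≡ N

-- f a + f (a + 1) + ⋯ + f b, which is 0 when b < a.
sumFromTo : ℕ → ℕ → (ℕ → ℕ) → ℕ
sumFromTo a b f = sum (map f (applyUpTo (λ k → a + k) (suc b ∸ a)))

AvoidingOfRank : (n t : ℕ) → Vec ℕ n → Set
AvoidingOfRank n t e =
  IsInversionSequence e ×
  Avoids e (1 ∷ 0 ∷ 2 ∷ []) ×
  Avoids e (1 ∷ 1 ∷ 0 ∷ []) ×
  rank e ≡ + t

{-# OPTIONS --safe #-}

-- A (102,110)-avoiding sequence with a descent attains its maximum M at the
-- first descent, at 0-based position p = M + t when the rank is t.  Removing
-- that entry leaves a shorter avoiding sequence, and this is reversible: into a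
-- sequence with a descent and rank s one may insert any M above its maximum μ
-- with M + t ≤ μ + s + 1; into a weakly increasing one, any M bounding it such
-- that the entry at position M + t is smaller than M.  Weakly increasing
-- sequences are counted by ballot numbers, and the sequences with a descent by
-- d(n,t) = Σ_{1 ≤ ℓ ≤ n} C(2ℓ-t-3, ℓ), which satisfies
-- d(n+1,t+1) = d(n,t) + d(n+1,t+2); hence d(n+1,t+1) also counts those of
-- length n with rank at least t, and d(n+2,t+2) the insertions of the first
-- kind.  Pascal's rule turns ballot number + d(n,t) into the stated formula.

module Submission where

open import Defs
open import Data.Integer.Base using (+_; _-_)
open import Data.Nat.Base using (ℕ; _*_; _∸_; _≤_)
open import Data.Nat.Combinatorics using (_C_)
open import Data.Product.Base using (_×_; ∃-syntax)
open import Relation.Binary.PropositionalEquality.Core using (_≡_)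

open import Algebra.Properties.CommutativeSemigroup using (interchange)
open import Data.Bool.Base using (if_then_else_)
open import Data.Empty using (⊥; ⊥-elim)
open import Data.Fin.Base using (Fin; zero; suc; toℕ; fromℕ; fromℕ<; inject₁; punchIn)
  renaming (_<_ to _<ᶠ_)
import Data.Fin.Properties as Fin
import Data.Integer.Base as ℤ
import Data.Integer.Properties as ℤ
import Data.Integer.Tactic.RingSolver as ℤ-Solver
open import Data.List.Base using ([]; _∷_; _++_; length; map; applyUpTo)
open import Data.List.Membership.Propositional using (_∈_)
open import Data.List.Membership.Propositional.Properties using (∈-++⁺ˡ; ∈-++⁺ʳ; ∈-++⁻)
open import Data.List.Properties using (length-++)
open import Data.List.Relation.Unary.All as All using (All; []; _∷_)
open import Data.List.Relation.Unary.AllPairs using ([]; _∷_)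
open import Data.List.Relation.Unary.Any using (here; there)
open import Data.List.Relation.Unary.Unique.Propositional using (Unique)
open import Data.List.Relation.Unary.Unique.Propositional.Properties using (++⁺)
open import Data.Nat.Base using (zero; suc; _+_; _<_; z≤n; s≤s; z<s; s<s)
open import Data.Nat.Combinatorics
  using (k>n⇒nCk≡0; nCk≡nC[n∸k]; nCn≡1; nCk+nC[k+1]≡[n+1]C[k+1])
open import Data.Nat.ListAction using (sum)
open import Data.Nat.Properties
open import Data.Nat.Tactic.RingSolver using (solve-∀)
open import Data.Product.Base using (_,_; proj₁; proj₂)
open import Data.Sum.Base using (_⊎_; inj₁; inj₂; [_,_]′)
open import Data.Vec.Base using (Vec; []; _∷_; lookup; insertAt; removeAt)
open import Data.Vec.Properties
  using (insertAt-lookup; insertAt-punchIn; removeAt-insertAt; insertAt-removeAt)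
open import Function.Base using (_∘_)
open import Function.Bundles using (_⇔_; mk⇔; module Equivalence)
open import Relation.Binary.Definitions using (tri<; tri≈; tri>)
open import Relation.Binary.PropositionalEquality
  using (refl; sym; trans; cong; cong₂; subst; subst₂; module ≡-Reasoning)
open import Relation.Nullary.Decidable using (yes; no; dec-true; dec-false)
open import Relation.Nullary.Negation.Core using (¬_)

open Equivalence using (to; from)

private
  variable
    A B : Set
    P Q : A → Set
    k m n t M N : ℕ

+-interchange : ∀ a b c d → (a + b) + (c + d) ≡ (a + c) + (b + d)
+-interchange = interchange +-commutativeSemigroup

-- Counting

HasCount-cong : (∀ x → P x ⇔ Q x) → HasCount P N → HasCount Q N
HasCount-cong P⇔Q (xs , unique , mem , len) =
  xs , unique ,
  (λ x → mk⇔ (to (P⇔Q x) ∘ to (mem x)) (from (mem x) ∘ from (P⇔Q x))) , len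

HasCount-∅ : (∀ x → ¬ P x) → HasCount P 0
HasCount-∅ ¬P = [] , [] , (λ x → mk⇔ (λ ()) (⊥-elim ∘ ¬P x)) , refl

HasCount-singleton : ∀ a → (∀ x → P x ⇔ x ≡ a) → HasCount P 1
HasCount-singleton a P⇔ =
  a ∷ [] , [] ∷ [] ,
  (λ x → mk⇔ (λ { (here x≡a) → from (P⇔ x) x≡a ; (there ()) }) (here ∘ to (P⇔ x))) , refl

HasCount-⊎ : (∀ x → P x → ¬ Q x) → HasCount P M → HasCount Q N →
             HasCount (λ x → P x ⊎ Q x) (M + N)
HasCount-⊎ disjoint (xs , u , mem , len) (ys , u′ , mem′ , len′) =
  xs ++ ys ,
  ++⁺ u u′ (λ (∈xs , ∈ys) → disjoint _ (to (mem _) ∈xs) (to (mem′ _) ∈ys)) ,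
  (λ x → mk⇔
    ([ inj₁ ∘ to (mem x) , inj₂ ∘ to (mem′ x) ]′ ∘ ∈-++⁻ xs)
    [ ∈-++⁺ˡ ∘ from (mem x) , ∈-++⁺ʳ xs ∘ from (mem′ x) ]′) ,
  trans (length-++ xs) (cong₂ _+_ len len′)

-- A bijection presented as a relation, which admits maps that are defined only on `P`. Injectivity
-- keeps the list of images free of repetitions, and `functional` identifies every image with the
-- one that `total` chose.
HasCount-transport :
  (R : A → B → Set) →
  (∀ {x} → P x → ∃[ y ] Q y × R x y) →
  (∀ {y} → Q y → ∃[ x ] P x × R x y) →
  (∀ {x y y′} → R x y → R x y′ → y ≡ y′) →
  (∀ {x x′ y} → P x → P x′ → R x y → R x′ y → x ≡ x′) →
  HasCount P N → HasCount Q N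
HasCount-transport {A = A} {B = B} {P = P} {Q = Q} R total onto functional injective
  (xs , unique , mem , len)
  with image xs unique (All.tabulate (to (mem _)))
  where
  image : ∀ xs → Unique xs → All P xs →
    ∃[ ys ] Unique ys × length ys ≡ length xs ×
      (∀ {y} → y ∈ ys → ∃[ x ] x ∈ xs × Q y × R x y) ×
      (∀ {x y} → x ∈ xs → R x y → y ∈ ys)
  image [] [] [] = [] , [] , refl , (λ ()) , (λ ())
  image (x ∷ xs) (x∉xs ∷ u) (px ∷ pxs)
    with image xs u pxs | total px
  ... | ys , u′ , len′ , back , forth | y , qy , xRy =
    y ∷ ys ,
    All.tabulate (λ y′∈ys y≡y′ →
      let x′ , x′∈xs , _ , x′Ry′ = back y′∈ys in
      All.lookup x∉xs x′∈xs
        (injective px (All.lookup pxs x′∈xs) xRy (subst (R x′) (sym y≡y′) x′Ry′)))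
      ∷ u′ ,
    cong suc len′ ,
    (λ { (here refl) → x , here refl , qy , xRy
       ; (there y∈ys) → let x′ , x′∈xs , r = back y∈ys in x′ , there x′∈xs , r }) ,
    (λ { (here refl) r → here (functional r xRy)
       ; (there x∈xs) r → there (forth x∈xs r) })
... | ys , u , len′ , back , forth =
  ys , u ,
  (λ y → mk⇔
    (λ y∈ys → proj₁ (proj₂ (proj₂ (back y∈ys))))
    (λ qy → let x , px , r = onto qy in forth (from (mem x) px) r)) ,
  trans len′ len

-- Descents and pattern avoidance

MonotoneUpTo : ℕ → Vec ℕ n → Set
MonotoneUpTo k e = ∀ {i j} → i <ᶠ j → toℕ j ≤ k → lookup e i ≤ lookup e j

Monotone : Vec ℕ n → Set
Monotone e = ∀ {i j} → i <ᶠ j → lookup e i ≤ lookup e j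

-- An index `next` after `p` must exist, so the conventional descent at the last entry is excluded;
-- sequences having only that one are the `Monotone` ones.
record Peak (e : Vec ℕ n) (p : Fin n) : Set where
  field
    next    : Fin n
    next≡   : toℕ next ≡ suc (toℕ p)
    rising  : MonotoneUpTo (toℕ p) e
    falling : lookup e next < lookup e p

  p<next : p <ᶠ next
  p<next = ≤-reflexive (sym next≡)

monotoneUpTo-∷ : ∀ {x y} {xs : Vec ℕ n} → x ≤ y →
  MonotoneUpTo k (y ∷ xs) → MonotoneUpTo (suc k) (x ∷ y ∷ xs)
monotoneUpTo-∷ x≤y mono {zero}  {suc zero}    _         _         = x≤y
monotoneUpTo-∷ x≤y mono {zero}  {suc (suc j)} _         (s≤s j≤k) =
  ≤-trans x≤y (mono {zero} z<s j≤k)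
monotoneUpTo-∷ x≤y mono {suc i} {suc j}       (s≤s i<j) (s≤s j≤k) = mono i<j j≤k

monotone-∷ : ∀ {x y} {xs : Vec ℕ n} → x ≤ y → Monotone (y ∷ xs) → Monotone (x ∷ y ∷ xs)
monotone-∷ x≤y mono {j = j} i<j =
  monotoneUpTo-∷ {k = toℕ j} x≤y (λ i<j′ _ → mono i<j′) i<j (n≤1+n _)

monotone-tail : ∀ {x} {xs : Vec ℕ n} → Monotone (x ∷ xs) → Monotone xs
monotone-tail mono i<j = mono (s<s i<j)

peak-suc : ∀ {x y} {xs : Vec ℕ n} {p} → x ≤ y → Peak (y ∷ xs) p → Peak (x ∷ y ∷ xs) (suc p)
peak-suc x≤y π = record
  { next = suc next ; next≡ = cong suc next≡
  ; rising = monotoneUpTo-∷ x≤y rising ; falling = falling }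
  where open Peak π

firstDescent : (e : Vec ℕ n) → Monotone e ⊎ ∃[ p ] Peak e p
firstDescent []       = inj₁ (λ { {()} })
firstDescent (x ∷ []) = inj₁ (λ { {zero} {zero} () })
firstDescent (x ∷ y ∷ e) with x ≤? y | firstDescent (y ∷ e)
... | no x≰y  | _             = inj₂ (zero , record
  { next = suc zero ; next≡ = refl
  ; rising = λ { {j = zero} () _ ; {j = suc _} _ () } ; falling = ≰⇒> x≰y })
... | yes x≤y | inj₁ mono     = inj₁ (monotone-∷ x≤y mono)
... | yes x≤y | inj₂ (p , π)  = inj₂ (suc p , peak-suc x≤y π)

-- Of two distinct peaks, the later one would require a rise across the fall at the earlier one.
peak-unique : ∀ {e : Vec ℕ n} {p q} → Peak e p → Peak e q → p ≡ q
peak-unique {p = p} {q} π ρ with <-cmp (toℕ p) (toℕ q)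
... | tri< p<q _ _ = ⊥-elim (<⇒≱ (Peak.falling π)
      (Peak.rising ρ (Peak.p<next π) (subst (_≤ _) (sym (Peak.next≡ π)) p<q)))
... | tri≈ _ p≡q _ = Fin.toℕ-injective p≡q
... | tri> _ _ q<p = ⊥-elim (<⇒≱ (Peak.falling ρ)
      (Peak.rising π (Peak.p<next ρ) (subst (_≤ _) (sym (Peak.next≡ ρ)) q<p)))

monotone⇒¬peak : ∀ {e : Vec ℕ n} {p} → Monotone e → ¬ Peak e p
monotone⇒¬peak mono π = <⇒≱ (Peak.falling π) (mono (Peak.p<next π))

fdes-∷-≤ : ∀ {x y} (xs : Vec ℕ n) → x ≤ y → fdes (x ∷ y ∷ xs) ≡ suc (fdes (y ∷ xs))
fdes-∷-≤ {x = x} {y} xs x≤y =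
  cong (λ b → if b then suc (fdes (y ∷ xs)) else 1) (dec-true (x ≤? y) x≤y)

fdes-∷-> : ∀ {x y} (xs : Vec ℕ n) → y < x → fdes (x ∷ y ∷ xs) ≡ 1
fdes-∷-> {x = x} {y} xs y<x =
  cong (λ b → if b then suc (fdes (y ∷ xs)) else 1) (dec-false (x ≤? y) (<⇒≱ y<x))

fdes-monotone : (e : Vec ℕ n) → Monotone e → fdes e ≡ n
fdes-monotone []          _    = refl
fdes-monotone (x ∷ [])    _    = refl
fdes-monotone (x ∷ y ∷ e) mono = trans
  (fdes-∷-≤ e (mono {zero} {suc zero} z<s))
  (cong suc (fdes-monotone (y ∷ e) (monotone-tail mono)))

fdes-peak : (e : Vec ℕ n) {p : Fin n} → Peak e p → fdes e ≡ suc (toℕ p)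
fdes-peak (x ∷ [])    {zero} record { next = zero ; next≡ = () }
fdes-peak (x ∷ y ∷ e) {zero} record { next = suc zero ; falling = y<x } = fdes-∷-> e y<x
fdes-peak (x ∷ y ∷ e) {suc p} record { next = suc q ; next≡ = q≡ ; rising = mono ; falling = ↓ } =
  trans (fdes-∷-≤ e (mono {zero} {suc zero} z<s (s≤s z≤n)))
        (cong suc (fdes-peak (y ∷ e) record
          { next = q ; next≡ = suc-injective q≡
          ; rising = λ i<j j≤p → mono (s<s i<j) (s≤s j≤p) ; falling = ↓ }))

lookup≤maxEntry : (e : Vec ℕ n) (i : Fin n) → lookup e i ≤ maxEntry e
lookup≤maxEntry (x ∷ e) zero    = m≤m⊔n x _
lookup≤maxEntry (x ∷ e) (suc i) = ≤-trans (lookup≤maxEntry e i) (m≤n⊔m x _)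

maxEntry≤ : ∀ {m} (e : Vec ℕ n) → (∀ i → lookup e i ≤ m) → maxEntry e ≤ m
maxEntry≤ []      _     = z≤n
maxEntry≤ (x ∷ e) bound = ⊔-lub (bound zero) (maxEntry≤ e (bound ∘ suc))

maxEntry≡ : (e : Vec ℕ n) (p : Fin n) → (∀ i → lookup e i ≤ lookup e p) →
  maxEntry e ≡ lookup e p
maxEntry≡ e p bound = ≤-antisym (maxEntry≤ e bound) (lookup≤maxEntry e p)

-- The first half forbids 102, the second 110.
Allowed : ℕ → ℕ → ℕ → Set
Allowed x y z = ¬ (y < x × x < z) × ¬ (x ≡ y × z < x)

Good : Vec ℕ n → Set
Good e = ∀ {i j k} → i <ᶠ j → j <ᶠ k → Allowed (lookup e i) (lookup e j) (lookup e k)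

-- By trichotomy, comparisons that are preserved in both forms `<` and `≡` are also reflected.
orderIsomorphic : (u w : Vec ℕ k) →
  (∀ a b → lookup w a < lookup w b → lookup u a < lookup u b) →
  (∀ a b → lookup w a ≡ lookup w b → lookup u a ≡ lookup u b) →
  OrderIsomorphic u w
orderIsomorphic u w mono-< mono-≡ a b = mk⇔ back-< (mono-< a b) , mk⇔ back-≡ (mono-≡ a b)
  where
  back-< : lookup u a < lookup u b → lookup w a < lookup w b
  back-< ua<ub with <-cmp (lookup w a) (lookup w b)
  ... | tri< wa<wb _ _ = wa<wb
  ... | tri≈ _ wa≡wb _ = ⊥-elim (<⇒≢ ua<ub (mono-≡ a b wa≡wb))
  ... | tri> _ _ wb<wa = ⊥-elim (<-asym ua<ub (mono-< b a wb<wa))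

  back-≡ : lookup u a ≡ lookup u b → lookup w a ≡ lookup w b
  back-≡ ua≡ub with <-cmp (lookup w a) (lookup w b)
  ... | tri< wa<wb _ _ = ⊥-elim (<⇒≢ (mono-< a b wa<wb) ua≡ub)
  ... | tri≈ _ wa≡wb _ = wa≡wb
  ... | tri> _ _ wb<wa = ⊥-elim (<⇒≢ (mono-< b a wb<wa) (sym ua≡ub))

pattern #0 = zero
pattern #1 = suc zero
pattern #2 = suc (suc zero)

isomorphic-102 : ∀ {x y z} →
  OrderIsomorphic (x ∷ y ∷ z ∷ []) (1 ∷ 0 ∷ 2 ∷ []) ⇔ (y < x × x < z)
isomorphic-102 {x} {y} {z} = mk⇔
  (λ iso → from (proj₁ (iso #1 #0)) (s≤s z≤n) , from (proj₁ (iso #0 #2)) (s≤s (s≤s z≤n)))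
  (λ (y<x , x<z) → orderIsomorphic (x ∷ y ∷ z ∷ []) (1 ∷ 0 ∷ 2 ∷ [])
    (λ { #1 #0 _ → y<x ; #1 #2 _ → <-trans y<x x<z ; #0 #2 _ → x<z
       ; #0 #0 (s≤s ()) ; #2 #0 (s≤s ()) ; #2 #2 (s≤s (s≤s ())) })
    (λ { #0 #0 _ → refl ; #1 #1 _ → refl ; #2 #2 _ → refl
       ; #0 #1 () ; #0 #2 () ; #1 #0 () ; #1 #2 () ; #2 #0 () ; #2 #1 () }))

isomorphic-110 : ∀ {x y z} →
  OrderIsomorphic (x ∷ y ∷ z ∷ []) (1 ∷ 1 ∷ 0 ∷ []) ⇔ (x ≡ y × z < x)
isomorphic-110 {x} {y} {z} = mk⇔
  (λ iso → from (proj₂ (iso #0 #1)) refl , from (proj₁ (iso #2 #0)) (s≤s z≤n))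
  (λ (x≡y , z<x) → orderIsomorphic (x ∷ y ∷ z ∷ []) (1 ∷ 1 ∷ 0 ∷ [])
    (λ { #2 #0 _ → z<x ; #2 #1 _ → subst (_ <_) x≡y z<x
       ; #0 #0 (s≤s ()) ; #0 #1 (s≤s ()) ; #1 #0 (s≤s ()) ; #1 #1 (s≤s ())
       ; #0 #2 () ; #1 #2 () ; #2 #2 () })
    (λ { #0 #0 _ → refl ; #1 #1 _ → refl ; #2 #2 _ → refl
       ; #0 #1 _ → x≡y ; #1 #0 _ → sym x≡y
       ; #0 #2 () ; #1 #2 () ; #2 #0 () ; #2 #1 () }))

avoids⇒good : (e : Vec ℕ n) →
  Avoids e (1 ∷ 0 ∷ 2 ∷ []) → Avoids e (1 ∷ 1 ∷ 0 ∷ []) → Good e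
avoids⇒good e ¬102 ¬110 i<j j<k =
  (λ r → ¬102 (_ , _ , _ , i<j , j<k , from isomorphic-102 r)) ,
  (λ r → ¬110 (_ , _ , _ , i<j , j<k , from isomorphic-110 r))

good⇒avoids-102 : (e : Vec ℕ n) → Good e → Avoids e (1 ∷ 0 ∷ 2 ∷ [])
good⇒avoids-102 e good (_ , _ , _ , i<j , j<k , iso) =
  proj₁ (good i<j j<k) (to isomorphic-102 iso)

good⇒avoids-110 : (e : Vec ℕ n) → Good e → Avoids e (1 ∷ 1 ∷ 0 ∷ [])
good⇒avoids-110 e good (_ , _ , _ , i<j , j<k , iso) =
  proj₂ (good i<j j<k) (to isomorphic-110 iso)

monotone⇒good : {e : Vec ℕ n} → Monotone e → Good e
monotone⇒good mono i<j j<k =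
  (λ (y<x , _) → <⇒≱ y<x (mono i<j)) ,
  (λ (_ , z<x) → <⇒≱ z<x (≤-trans (mono i<j) (mono j<k)))

-- Entries up to the peak rise to it, and the next one is smaller. A larger entry further on would
-- form a 102 with the peak and its successor.
peak-maximal : {e : Vec ℕ n} {p : Fin n} → Good e → Peak e p →
  ∀ i → lookup e i ≤ lookup e p
peak-maximal {e = e} {p} good π i with <-cmp (toℕ i) (toℕ p)
... | tri< i<p _ _ = Peak.rising π i<p ≤-refl
... | tri≈ _ i≡p _ = ≤-reflexive (cong (lookup e) (Fin.toℕ-injective i≡p))
... | tri> _ _ p<i with m≤n⇒m<n∨m≡n (subst (_≤ toℕ i) (sym (Peak.next≡ π)) p<i)
...   | inj₁ next<i = ≮⇒≥ (λ ep<ei →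
          proj₁ (good (Peak.p<next π) next<i) (Peak.falling π , ep<ei))
...   | inj₂ next≡i = <⇒≤ (subst (λ j → lookup e j < lookup e p)
          (Fin.toℕ-injective next≡i) (Peak.falling π))

-- With the 0-based peak position `p`, the rank fdes - max - 1 is p - max, and the maximum sits at
-- `p`; `height` says that this is `t` without a subtraction.
record Descending (t : ℕ) (e : Vec ℕ n) : Set where
  field
    inversion : IsInversionSequence e
    good      : Good e
    p         : Fin n
    peak      : Peak e p
    height    : toℕ p ≡ lookup e p + t

  open Peak peak public

  maximal : ∀ i → lookup e i ≤ lookup e p
  maximal = peak-maximal good peak

  max≡ : maxEntry e ≡ lookup e p
  max≡ = maxEntry≡ e p maximal

  height′ : toℕ p ≡ maxEntry e + t
  height′ = trans height (cong (_+ t) (sym max≡))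

descending-rank-unique : ∀ {s t} {e : Vec ℕ n} → Descending s e → Descending t e → s ≡ t
descending-rank-unique {e = e} D D′ =
  +-cancelˡ-≡ (maxEntry e) _ _ (trans (sym (Descending.height′ D))
    (trans (cong toℕ (peak-unique (Descending.peak D) (Descending.peak D′)))
           (Descending.height′ D′)))

-- Removing the entry at the first descent

data Punched (p : Fin (suc n)) : Fin (suc n) → Set where
  at  : Punched p p
  off : ∀ j → Punched p (punchIn p j)

punched : (p i : Fin (suc n)) → Punched p i
punched             zero    zero    = at
punched             zero    (suc i) = off i
punched {n = suc _} (suc p) zero    = off zero
punched {n = suc _} (suc p) (suc i) with punched p i
... | at    = at
... | off j = off (suc j)

toℕ-punchIn-< : (p : Fin (suc n)) (j : Fin n) → toℕ j < toℕ p → toℕ (punchIn p j) ≡ toℕ j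
toℕ-punchIn-< (suc p) zero    _         = refl
toℕ-punchIn-< (suc p) (suc j) (s≤s j<p) = cong suc (toℕ-punchIn-< p j j<p)

toℕ-punchIn-≥ : (p : Fin (suc n)) (j : Fin n) → toℕ p ≤ toℕ j →
  toℕ (punchIn p j) ≡ suc (toℕ j)
toℕ-punchIn-≥ zero    j       _         = refl
toℕ-punchIn-≥ (suc p) (suc j) (s≤s p≤j) = cong suc (toℕ-punchIn-≥ p j p≤j)

j≤punchIn : (p : Fin (suc n)) (j : Fin n) → toℕ j ≤ toℕ (punchIn p j)
j≤punchIn zero    j       = n≤1+n _
j≤punchIn (suc p) zero    = z≤n
j≤punchIn (suc p) (suc j) = s≤s (j≤punchIn p j)

punchIn-mono-< : (p : Fin (suc n)) {i j : Fin n} → i <ᶠ j → punchIn p i <ᶠ punchIn p j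
punchIn-mono-< p {i} {j} i<j =
  ≰⇒> (λ pj≤pi → <⇒≱ i<j (Fin.punchIn-cancel-≤ p j i pj≤pi))

punchIn-cancel-< : (p : Fin (suc n)) {i j : Fin n} → punchIn p i <ᶠ punchIn p j → i <ᶠ j
punchIn-cancel-< p {i} {j} pi<pj =
  ≰⇒> (λ j≤i → <⇒≱ pi<pj (Fin.punchIn-mono-≤ p j i j≤i))

punchIn-<⁻ : (p : Fin (suc n)) {j : Fin n} → punchIn p j <ᶠ p → toℕ j < toℕ p
punchIn-<⁻ p {j} = ≤-<-trans (j≤punchIn p j)

punchIn-<⁺ : (p : Fin (suc n)) {j : Fin n} → toℕ j < toℕ p → punchIn p j <ᶠ p
punchIn-<⁺ p {j} j<p = subst (_< toℕ p) (sym (toℕ-punchIn-< p j j<p)) j<p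

punchIn->⁺ : (p : Fin (suc n)) {j : Fin n} → toℕ p ≤ toℕ j → p <ᶠ punchIn p j
punchIn->⁺ p {j} p≤j = subst (toℕ p <_) (sym (toℕ-punchIn-≥ p j p≤j)) (s≤s p≤j)

punchIn-inject₁ : (q : Fin n) → punchIn (inject₁ q) q ≡ suc q
punchIn-inject₁ zero    = refl
punchIn-inject₁ (suc q) = cong suc (punchIn-inject₁ q)

inject₁-surjective : (p : Fin (suc n)) → toℕ p < n → ∃[ q ] inject₁ q ≡ p
inject₁-surjective p p<n = fromℕ< p<n ,
  Fin.toℕ-injective (trans (Fin.toℕ-inject₁ _) (Fin.toℕ-fromℕ< p<n))

insertAt-injective : {e e′ : Vec ℕ n} {x y : ℕ} (p : Fin (suc n)) →
  insertAt e p x ≡ insertAt e′ p y → e ≡ e′ × x ≡ y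
insertAt-injective {e = e} {e′} {x} {y} p eq =
  trans (sym (removeAt-insertAt e p x))
    (trans (cong (λ v → removeAt v p) eq) (removeAt-insertAt e′ p y)) ,
  trans (sym (insertAt-lookup e p x))
    (trans (cong (λ v → lookup v p) eq) (insertAt-lookup e′ p y))

module Insertion (e : Vec ℕ n) (p : Fin (suc n)) (m : ℕ) where

  ê : Vec ℕ (suc n)
  ê = insertAt e p m

  lookup-at : lookup ê p ≡ m
  lookup-at = insertAt-lookup e p m

  lookup-off : ∀ j → lookup ê (punchIn p j) ≡ lookup e j
  lookup-off = insertAt-punchIn e p m

  good⁻ : Good ê → Good e
  good⁻ good {i} {j} {k} i<j j<k
    with r ← good (punchIn-mono-< p i<j) (punchIn-mono-< p j<k)
    rewrite lookup-off i | lookup-off j | lookup-off k = r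

  monotone⁻ : Monotone ê → Monotone e
  monotone⁻ mono {i} {j} i<j =
    subst₂ _≤_ (lookup-off i) (lookup-off j) (mono (punchIn-mono-< p i<j))

  -- Entries behind the removed one move left and could break their bound. They stay within it
  -- because each is at most `m`, and `m` is at most its own position `p`.
  inversion⁻ : IsInversionSequence ê → (∀ j → lookup e j ≤ m) → IsInversionSequence e
  inversion⁻ inv bound j with toℕ j <? toℕ p
  ... | yes j<p = subst₂ _≤_ (lookup-off j) (toℕ-punchIn-< p j j<p) (inv (punchIn p j))
  ... | no  j≮p = ≤-trans (bound j)
        (≤-trans (subst (_≤ toℕ p) lookup-at (inv p)) (≮⇒≥ j≮p))

  inversion⁺ : IsInversionSequence e → m ≤ toℕ p → IsInversionSequence ê
  inversion⁺ inv m≤p i with punched p i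
  ... | at    = subst (_≤ toℕ p) (sym lookup-at) m≤p
  ... | off j = subst (_≤ toℕ (punchIn p j)) (sym (lookup-off j))
                  (≤-trans (inv j) (j≤punchIn p j))

  bound⁺ : (∀ j → lookup e j ≤ m) → ∀ i → lookup ê i ≤ m
  bound⁺ bound i with punched p i
  ... | at    = ≤-reflexive lookup-at
  ... | off j = subst (_≤ m) (sym (lookup-off j)) (bound j)

  bound⁻ : (∀ i → lookup ê i ≤ lookup ê p) → ∀ j → lookup e j ≤ m
  bound⁻ bound j = subst₂ _≤_ (lookup-off j) lookup-at (bound (punchIn p j))

  risingTo⁺ : (∀ {i j} → i <ᶠ j → toℕ j < toℕ p → lookup e i ≤ lookup e j) →
    (∀ {i} → toℕ i < toℕ p → lookup e i ≤ m) → MonotoneUpTo (toℕ p) ê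
  risingTo⁺ before before≤ {i} {j} i<j j≤p with punched p i | punched p j
  ... | at    | at    = ≤-refl
  ... | at    | off j = ⊥-elim (<⇒≱ i<j j≤p)
  ... | off i | at    = subst₂ _≤_ (sym (lookup-off i)) (sym lookup-at)
                          (before≤ (punchIn-<⁻ p i<j))
  ... | off i | off j = subst₂ _≤_ (sym (lookup-off i)) (sym (lookup-off j))
                          (before (punchIn-cancel-< p i<j)
                            (punchIn-<⁻ p (≤∧≢⇒< j≤p (Fin.punchInᵢ≢i p j ∘ Fin.toℕ-injective))))

  -- The cases follow the role of the inserted entry in a triple. As first entry, `bound` excludes
  -- 102 and `stay` excludes 110; as second, `bound` and `before<` do so; as third, `before` and
  -- `bound`.
  good⁺ : (∀ {i j} → i <ᶠ j → toℕ j < toℕ p → lookup e i ≤ lookup e j) →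
    (∀ {i} → toℕ i < toℕ p → lookup e i < m) →
    (∀ j → lookup e j ≤ m) →
    (∀ {j k} → j <ᶠ k → lookup e j ≡ m → m ≤ lookup e k) →
    Good e → Good ê
  good⁺ before before< bound stay good {i} {j} {k} i<j j<k
    with punched p i | punched p j | punched p k
  ... | at    | at    | _     = ⊥-elim (<-irrefl refl i<j)
  ... | _     | at    | at    = ⊥-elim (<-irrefl refl j<k)
  ... | at    | off _ | at    = ⊥-elim (<-asym i<j j<k)
  ... | off i | off j | off k
        rewrite lookup-off i | lookup-off j | lookup-off k =
          good (punchIn-cancel-< p i<j) (punchIn-cancel-< p j<k)
  ... | at    | off j | off k
        rewrite lookup-at | lookup-off j | lookup-off k =
          (λ (_ , m<z) → <⇒≱ m<z (bound k)) ,
          (λ (m≡y , z<m) → <⇒≱ z<m (stay (punchIn-cancel-< p j<k) (sym m≡y)))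
  ... | off i | at    | off k
        rewrite lookup-off i | lookup-at | lookup-off k =
          (λ (m<x , _) → <⇒≱ m<x (bound i)) ,
          (λ (x≡m , _) → <⇒≢ (before< (punchIn-<⁻ p i<j)) x≡m)
  ... | off i | off j | at
        rewrite lookup-off i | lookup-off j | lookup-at =
          (λ (y<x , _) → <⇒≱ y<x (before (punchIn-cancel-< p i<j) (punchIn-<⁻ p j<k))) ,
          (λ (_ , m<x) → <⇒≱ m<x (bound i))

-- What both kinds of insertion have in common. The index `q` lies in `Fin n`, so an old entry
-- directly follows the inserted one and `drop` makes it a descent; `stay` prevents a 110 that
-- starts at the inserted `m`.
record Insertable (t : ℕ) (e : Vec ℕ n) (m : ℕ) : Set where
  field
    inversion : IsInversionSequence e
    good      : Good e
    q         : Fin n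
    q≡        : toℕ q ≡ m + t
    before    : ∀ {i j} → i <ᶠ j → toℕ j < toℕ q → lookup e i ≤ lookup e j
    before<   : ∀ {i} → toℕ i < toℕ q → lookup e i < m
    drop      : lookup e q < m
    bound     : ∀ j → lookup e j ≤ m
    stay      : ∀ {j k} → j <ᶠ k → lookup e j ≡ m → m ≤ lookup e k

insertable⇒descending : ∀ {e : Vec ℕ n} {m} (I : Insertable t e m) →
  Descending t (insertAt e (inject₁ (Insertable.q I)) m)
insertable⇒descending {n = n} {t = t} {e = e} {m} I = record
  { inversion = inversion⁺ inversion (≤-trans (m≤m+n m t) (≤-reflexive (sym p≡)))
  ; good      = good⁺ before′ before<′ bound stay good
  ; p         = p
  ; peak      = record
    { next    = suc q
    ; next≡   = cong suc (sym (Fin.toℕ-inject₁ q))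
    ; rising  = risingTo⁺ before′ (<⇒≤ ∘ before<′)
    ; falling = subst₂ _<_
        (trans (sym (lookup-off q)) (cong (lookup ê) (punchIn-inject₁ q)))
        (sym lookup-at) drop
    }
  ; height    = trans p≡ (cong (_+ t) (sym lookup-at))
  }
  where
  open Insertable I
  p : Fin (suc n)
  p = inject₁ q
  open Insertion e p m

  p≡ : toℕ p ≡ m + t
  p≡ = trans (Fin.toℕ-inject₁ q) q≡

  before′ : ∀ {i j} → i <ᶠ j → toℕ j < toℕ p → lookup e i ≤ lookup e j
  before′ i<j j<p = before i<j (subst (_ <_) (Fin.toℕ-inject₁ q) j<p)

  before<′ : ∀ {i} → toℕ i < toℕ p → lookup e i < m
  before<′ i<p = before< (subst (_ <_) (Fin.toℕ-inject₁ q) i<p)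

record MonotoneBelow (t : ℕ) (e : Vec ℕ n) (m : ℕ) : Set where
  field
    inversion : IsInversionSequence e
    monotone  : Monotone e
    bound     : ∀ j → lookup e j ≤ m
    q         : Fin n
    q≡        : toℕ q ≡ m + t
    drop      : lookup e q < m

  insertable : Insertable t e m
  insertable = record
    { inversion = inversion ; good = monotone⇒good {e = e} monotone ; q = q ; q≡ = q≡
    ; before = λ i<j _ → monotone i<j
    ; before< = λ i<q → ≤-<-trans (monotone i<q) drop
    ; drop = drop ; bound = bound
    ; stay = λ { j<k refl → monotone j<k } }

-- `maxEntry e + s` is the position of the old first descent. The last inequality puts the new entry
-- at most one place behind it, so that everything before the new entry is weakly increasing.
DescendingBelow : ℕ → Vec ℕ n → ℕ → Set
DescendingBelow t e m =
  ∃[ s ] Descending s e × maxEntry e < m × m + t ≤ suc (maxEntry e + s)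

descendingBelow-insertable : ∀ {e : Vec ℕ n} {m} → DescendingBelow t e m → Insertable t e m
descendingBelow-insertable {n = n} {t = t} {e = e} {m} (s , D , max<m , m+t≤) = record
  { inversion = inversion ; good = good ; q = fromℕ< q<n ; q≡ = Fin.toℕ-fromℕ< q<n
  ; before = λ {_} {j} i<j j<q → rising i<j
      (m<1+n⇒m≤n (<-≤-trans (subst (toℕ j <_) (Fin.toℕ-fromℕ< q<n) j<q) m+t≤p))
  ; before< = λ {i} _ → below i
  ; drop = below _ ; bound = <⇒≤ ∘ below
  ; stay = λ {j} _ ej≡m → ⊥-elim (<⇒≢ (below j) ej≡m) }
  where
  open Descending D
  m+t≤p : m + t ≤ suc (toℕ p)
  m+t≤p = subst (λ h → m + t ≤ suc h) (sym height′) m+t≤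

  -- The old peak has a successor, so the insertion position is at most that of an existing entry.
  q<n : m + t < n
  q<n = ≤-<-trans (subst (m + t ≤_) (sym next≡) m+t≤p) (Fin.toℕ<n next)

  below : ∀ j → lookup e j < m
  below j = ≤-<-trans (lookup≤maxEntry e j) max<m

Removed : ℕ → Vec ℕ n × ℕ → Set
Removed t (e , m) = MonotoneBelow t e m ⊎ DescendingBelow t e m

-- A relation, because the index `q` exists only when `m + t < n`.
InsertedAs : ℕ → Vec ℕ n × ℕ → Vec ℕ (suc n) → Set
InsertedAs t (e , m) ê = ∃[ q ] toℕ q ≡ m + t × ê ≡ insertAt e (inject₁ q) m

removed-insertable : (x : Vec ℕ n × ℕ) → Removed t x → Insertable t (proj₁ x) (proj₂ x)
removed-insertable _ (inj₁ V) = MonotoneBelow.insertable V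
removed-insertable _ (inj₂ X) = descendingBelow-insertable X

-- The sequence is given in inserted form so that `Insertion` applies. If the rest still has a
-- descent, a value `m` at its peak would contradict `stay`, so its maximum is below `m`; and its
-- fall cannot lie wholly before `q`, which bounds `m + t`.
removal : ∀ {e : Vec ℕ n} {q m} → (D : Descending t (insertAt e (inject₁ q) m)) →
  Descending.p D ≡ inject₁ q → Removed t (e , m) × toℕ q ≡ m + t
removal {n = n} {t = t} {e = e} {q} {m} D p≡ = removed , q≡
  where
  open Insertion e (inject₁ q) m
  open Descending D using (height) renaming (inversion to inv̂; good to good̂)

  p̂ : Fin (suc n)
  p̂ = inject₁ q

  peak̂ : Peak ê p̂
  peak̂ = subst (Peak ê) p≡ (Descending.peak D)

  q≡ : toℕ q ≡ m + t
  q≡ = trans (sym (Fin.toℕ-inject₁ q)) (trans (cong toℕ (sym p≡))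
    (trans height (cong (_+ t) (trans (cong (lookup ê) p≡) lookup-at))))

  bound : ∀ j → lookup e j ≤ m
  bound = bound⁻ (peak-maximal good̂ peak̂)

  inv : IsInversionSequence e
  inv = inversion⁻ inv̂ bound

  good : Good e
  good = good⁻ good̂

  next̂≡ : Peak.next peak̂ ≡ suc q
  next̂≡ = Fin.toℕ-injective (trans (Peak.next≡ peak̂) (cong suc (Fin.toℕ-inject₁ q)))

  drop : lookup e q < m
  drop = subst₂ _<_
    (trans (cong (lookup ê) (trans next̂≡ (sym (punchIn-inject₁ q)))) (lookup-off q))
    lookup-at (Peak.falling peak̂)

  before : ∀ {i j} → i <ᶠ j → toℕ j < toℕ q → lookup e i ≤ lookup e j
  before {i} {j} i<j j<q = subst₂ _≤_ (lookup-off i) (lookup-off j)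
    (Peak.rising peak̂ (punchIn-mono-< p̂ i<j)
      (<⇒≤ (punchIn-<⁺ p̂ (subst (toℕ j <_) (sym (Fin.toℕ-inject₁ q)) j<q))))

  -- An earlier m, the peak and the drop would form a 110.
  before≢ : ∀ {i} → toℕ i < toℕ q → ¬ lookup e i ≡ m
  before≢ {i} i<q ei≡m = proj₂ (good̂ (punchIn-<⁺ p̂ i<p) (Peak.p<next peak̂))
    ( trans (lookup-off i) (trans ei≡m (sym lookup-at))
    , subst (_ <_) (trans lookup-at (sym (trans (lookup-off i) ei≡m))) (Peak.falling peak̂))
    where
    i<p : toℕ i < toℕ p̂
    i<p = subst (toℕ i <_) (sym (Fin.toℕ-inject₁ q)) i<q

  -- The inserted m, a later m and a smaller entry after it would form a 110.
  stay : ∀ {j k} → j <ᶠ k → lookup e j ≡ m → m ≤ lookup e k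
  stay {j} {k} j<k ej≡m with toℕ j <? toℕ q
  ... | yes j<q = ⊥-elim (before≢ j<q ej≡m)
  ... | no  j≮q = ≮⇒≥ (λ ek<m →
    proj₂ (good̂ (punchIn->⁺ p̂ (subst (_≤ toℕ j) (sym (Fin.toℕ-inject₁ q)) (≮⇒≥ j≮q)))
                (punchIn-mono-< p̂ j<k))
      ( trans lookup-at (sym (trans (lookup-off j) ej≡m))
      , subst₂ _<_ (sym (lookup-off k)) (sym lookup-at) ek<m))

  removed : Removed t (e , m)
  removed with firstDescent e
  ... | inj₁ mono = inj₁ (record
    { inversion = inv ; monotone = mono ; bound = bound ; q = q ; q≡ = q≡ ; drop = drop })
  ... | inj₂ (p , π) = inj₂ (s , D′ , max<m , m+t≤)
    where
    -- This subtraction is exact, since `lookup e p ≤ toℕ p` in an inversion sequence.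
    s : ℕ
    s = toℕ p ∸ lookup e p

    D′ : Descending s e
    D′ = record { inversion = inv ; good = good ; p = p ; peak = π
                ; height = sym (m+[n∸m]≡n (inv p)) }

    max<m : maxEntry e < m
    max<m = subst (_< m) (sym (Descending.max≡ D′)) (≤∧≢⇒< (bound p) (λ ep≡m →
      <⇒≱ (Peak.falling π) (subst (_≤ _) (sym ep≡m) (stay (Peak.p<next π) ep≡m))))

    m+t≤ : m + t ≤ suc (maxEntry e + s)
    m+t≤ = subst₂ (λ a b → a ≤ suc b) q≡ (Descending.height′ D′)
      (≮⇒≥ (λ sp<q → <⇒≱ (Peak.falling π)
        (before (Peak.p<next π) (subst (_< toℕ q) (sym (Peak.next≡ π)) sp<q))))

descending⇒removed : ∀ {ê : Vec ℕ (suc n)} → Descending t ê →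
  ∃[ x ] Removed t x × InsertedAs t x ê
descending⇒removed {n = n} {t = t} {ê = ê} D
  with inject₁-surjective (Descending.p D) p<n
  where
  -- The peak has a successor, hence is not the last position and has the form `inject₁ q`.
  p<n : toℕ (Descending.p D) < n
  p<n = m<1+n⇒m≤n (subst (_< suc n) (Descending.next≡ D) (Fin.toℕ<n (Descending.next D)))
... | q , q≡p = (removeAt ê (inject₁ q) , lookup ê (inject₁ q)) , r , q , q≡ , sym eq
  where
  eq : insertAt (removeAt ê (inject₁ q)) (inject₁ q) (lookup ê (inject₁ q)) ≡ ê
  eq = insertAt-removeAt ê (inject₁ q)

  D′ : Descending t (insertAt (removeAt ê (inject₁ q)) (inject₁ q) (lookup ê (inject₁ q)))
  D′ = subst (Descending t) (sym eq) D

  p′≡ : Descending.p D′ ≡ inject₁ q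
  p′≡ = trans (peak-unique (Descending.peak D′)
                (subst (λ v → Peak v (Descending.p D)) (sym eq) (Descending.peak D)))
              (sym q≡p)

  r : Removed t (removeAt ê (inject₁ q) , lookup ê (inject₁ q))
  r = proj₁ (removal D′ p′≡)

  q≡ : toℕ q ≡ lookup ê (inject₁ q) + t
  q≡ = proj₂ (removal D′ p′≡)

removed⇒descending : ∀ {x : Vec ℕ n × ℕ} → Removed t x →
  ∃[ ê ] Descending t ê × InsertedAs t x ê
removed⇒descending {t = t} {x = x} r =
  _ , insertable⇒descending I , Insertable.q I , Insertable.q≡ I , refl
  where
  I : Insertable t _ _
  I = removed-insertable x r

insertedAs-functional : ∀ {x : Vec ℕ n × ℕ} {e e′} →
  InsertedAs t x e → InsertedAs t x e′ → e ≡ e′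
insertedAs-functional {x = e , m} (q , q≡ , refl) (q′ , q′≡ , refl) =
  cong (λ p → insertAt e (inject₁ p) m) (Fin.toℕ-injective (trans q≡ (sym q′≡)))

-- Both insertions place their entry at the first descent of `e`, so the positions agree; deleting
-- it then recovers the sequence and the value.
insertedAs-injective : ∀ {x y : Vec ℕ n × ℕ} {e} → Removed t x → Removed t y →
  InsertedAs t x e → InsertedAs t y e → x ≡ y
insertedAs-injective {t = t} {x = x@(e , m)} {y@(e′ , m′)} r r′ (q , q≡ , refl) (q′ , q′≡ , eq)
  with Fin.inject₁-injective (peak-unique
         (subst (λ v → Peak v (inject₁ q)) eq (peakOf x r q q≡))
         (peakOf y r′ q′ q′≡))
  where
  peakOf : (x : Vec ℕ _ × ℕ) → Removed t x → ∀ q → toℕ q ≡ proj₂ x + t →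
    Peak (insertAt (proj₁ x) (inject₁ q) (proj₂ x)) (inject₁ q)
  peakOf x r q q≡ = subst (λ q → Peak (insertAt (proj₁ x) (inject₁ q) (proj₂ x)) (inject₁ q))
    (Fin.toℕ-injective (trans (Insertable.q≡ I) (sym q≡)))
    (Descending.peak (insertable⇒descending I))
    where
    I : Insertable t (proj₁ x) (proj₂ x)
    I = removed-insertable x r
... | refl with insertAt-injective (inject₁ q) eq
...   | refl , refl = refl

-- Binomial coefficients

-- a choose (k - j), read as 0 when k < j
choose : (j a k : ℕ) → ℕ
choose zero    a k       = a C k
choose (suc j) a zero    = 0
choose (suc j) a (suc k) = choose j a k

nC0≡1 : ∀ n → n C 0 ≡ 1
nC0≡1 n = trans (nCk≡nC[n∸k] {0} {n} z≤n) (nCn≡1 n)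

-- With negative lower indices read as 0, Pascal's rule needs no side condition.
choose-pascal : ∀ j a k → choose j (suc a) k ≡ choose j a k + choose (suc j) a k
choose-pascal zero    a zero    = trans (nC0≡1 (suc a)) (cong (_+ 0) (sym (nC0≡1 a)))
choose-pascal zero    a (suc k) =
  trans (sym (nCk+nC[k+1]≡[n+1]C[k+1] a k)) (+-comm (a C k) (a C suc k))
choose-pascal (suc j) a zero    = refl
choose-pascal (suc j) a (suc k) = choose-pascal j a k

C-sym : ∀ a b → (a + b) C a ≡ (a + b) C b
C-sym a b = trans (nCk≡nC[n∸k] (m≤m+n a b)) (cong ((a + b) C_) (m+n∸m≡n a b))

-- Truncation is harmless: for ℓ ≥ 1 a vanishing upper index gives 0, and `descentCount` starts its
-- sum at ℓ = 1.
stepCount : ℕ → ℕ → ℕ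
stepCount ℓ t = (ℓ + ℓ ∸ (3 + t)) C ℓ

descentCount : ℕ → ℕ → ℕ
descentCount zero    t = 0
descentCount (suc n) t = descentCount n t + stepCount (suc n) t

-- For ℓ ≤ t + 2 the upper index 2ℓ - t - 3 is at most ℓ - 1.
stepCount-zero : ∀ l t → suc l ≤ 2 + t → stepCount (suc l) t ≡ 0
stepCount-zero l t l<t = k>n⇒nCk≡0 (≤-<-trans
  (≤-trans (∸-monoʳ-≤ (suc l + suc l) (s≤s l<t))
    (≤-reflexive (trans (cong (_∸ suc l) (+-comm l (suc l))) (m+n∸m≡n (suc l) l))))
  (n<1+n l))

-- For `a < c` all three upper indices are 0, and the binomials vanish because their lower indices
-- are positive.
C-pascal-∸ : ∀ a c k → (suc a ∸ c) C (2 + k) ≡ (a ∸ c) C (1 + k) + (a ∸ c) C (2 + k)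
C-pascal-∸ a c k with <-≤-connex a c
... | inj₁ a<c rewrite m≤n⇒m∸n≡0 a<c | m≤n⇒m∸n≡0 (<⇒≤ a<c) = refl
... | inj₂ c≤a rewrite +-∸-assoc 1 c≤a = sym (nCk+nC[k+1]≡[n+1]C[k+1] (a ∸ c) (1 + k))

-- Raising ℓ and `t` both by one raises the upper index 2ℓ - t - 3 by one, while raising ℓ by one
-- and `t` by two keeps it; Pascal's rule connects the three.
stepCount-pascal : ∀ l t →
  stepCount (2 + l) (1 + t) ≡ stepCount (1 + l) t + stepCount (2 + l) (2 + t)
stepCount-pascal l t = subst
  (λ b → (b ∸ (3 + t)) C (2 + l) ≡
         (suc l + suc l ∸ (3 + t)) C (1 + l) + (b ∸ (4 + t)) C (2 + l))
  (sym (+-suc (suc l) (suc l)))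
  (C-pascal-∸ (suc l + suc l) (3 + t) l)

-- The recurrence for single terms, summed over ℓ; the terms with ℓ = 1 at `1 + t` and `2 + t` are
-- zero.
descentCount-pascal : ∀ n t →
  descentCount (1 + n) (1 + t) ≡ descentCount n t + descentCount (1 + n) (2 + t)
descentCount-pascal zero    t = refl
descentCount-pascal (suc n) t = begin
  descentCount (1 + n) (1 + t) + stepCount (2 + n) (1 + t)
    ≡⟨ cong₂ _+_ (descentCount-pascal n t) (stepCount-pascal n t) ⟩
  (descentCount n t + descentCount (1 + n) (2 + t)) + (stepCount (1 + n) t + stepCount (2 + n) (2 + t))
    ≡⟨ +-interchange (descentCount n t) _ _ _ ⟩
  (descentCount n t + stepCount (1 + n) t) + (descentCount (1 + n) (2 + t) + stepCount (2 + n) (2 + t))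
    ∎
  where open ≡-Reasoning

descentCount-zero : ∀ n t → n ≤ 2 + t → descentCount n t ≡ 0
descentCount-zero zero    t _    = refl
descentCount-zero (suc n) t n<t =
  cong₂ _+_ (descentCount-zero n t (<⇒≤ n<t)) (stepCount-zero n t n<t)

-- The subtraction in stepCount does not truncate here, and the binomial is
-- replaced by its mirror image.
stepCount-choose : ∀ t k → stepCount (2 + t + k) t ≡ choose 1 (1 + t + k + k) k
stepCount-choose t zero    = stepCount-zero (1 + t + 0) t
  (≤-reflexive (cong (λ x → 2 + x) (+-identityʳ t)))
stepCount-choose t (suc k) = begin
  stepCount (2 + t + suc k) t
    ≡⟨ cong (λ ℓ → stepCount ℓ t) (+-suc (2 + t) k) ⟩
  (3 + t + k + (3 + t + k) ∸ (3 + t)) C (3 + t + k)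
    ≡⟨ cong (_C (3 + t + k)) (trans
         (cong (_∸ (3 + t)) (+-assoc (3 + t) k _)) (m+n∸m≡n (3 + t) _)) ⟩
  (k + (3 + t + k)) C (3 + t + k)
    ≡⟨ C-sym k (3 + t + k) ⟨
  (k + (3 + t + k)) C k
    ≡⟨ cong (_C k) (mirror t k) ⟩
  (1 + t + suc k + suc k) C k
    ∎
  where
  open ≡-Reasoning

  mirror : ∀ t k → k + (3 + t + k) ≡ 1 + t + suc k + suc k
  mirror = solve-∀

-- Weakly increasing sequences

record UpTo (m : ℕ) (e : Vec ℕ n) : Set where
  field
    inversion : IsInversionSequence e
    monotone  : Monotone e
    bound     : ∀ j → lookup e j ≤ m

record EndsAt (m : ℕ) (e : Vec ℕ (suc n)) : Set where
  field
    inversion : IsInversionSequence e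
    monotone  : Monotone e
    last≡     : lookup e (fromℕ n) ≡ m

monotone-bound : (e : Vec ℕ (suc n)) → Monotone e → ∀ i → lookup e i ≤ lookup e (fromℕ n)
monotone-bound e mono i with m≤n⇒m<n∨m≡n (Fin.≤fromℕ i)
... | inj₁ i<last = mono i<last
... | inj₂ i≡last = ≤-reflexive (cong (lookup e) (Fin.toℕ-injective i≡last))

monotone-append : {e : Vec ℕ n} → Monotone e → (∀ j → lookup e j ≤ m) →
  Monotone (insertAt e (fromℕ n) m)
monotone-append {n = n} {m = m} {e = e} mono bound {j = j} i<j =
  risingTo⁺ (λ i<j _ → mono i<j) (λ _ → bound _) i<j (Fin.≤fromℕ j)
  where open Insertion e (fromℕ n) m

inversion-append : {e : Vec ℕ n} → IsInversionSequence e → m ≤ n →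
  IsInversionSequence (insertAt e (fromℕ n) m)
inversion-append {n = n} {m = m} {e = e} inv m≤n =
  inversion⁺ inv (subst (m ≤_) (sym (Fin.toℕ-fromℕ n)) m≤n)
  where open Insertion e (fromℕ n) m

endsAt⁺ : {e : Vec ℕ n} → m ≤ n → UpTo m e → EndsAt m (insertAt e (fromℕ n) m)
endsAt⁺ {n = n} {m = m} {e = e} m≤n U = record
  { inversion = inversion-append inversion m≤n
  ; monotone  = monotone-append monotone bound
  ; last≡     = insertAt-lookup e (fromℕ n) m }
  where open UpTo U

endsAt⁻ : {e : Vec ℕ n} → EndsAt m (insertAt e (fromℕ n) m) → UpTo m e
endsAt⁻ {n = n} {m = m} {e = e} E = record
  { inversion = inversion⁻ inversion (bound⁻ (monotone-bound ê monotone))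
  ; monotone  = monotone⁻ monotone
  ; bound     = bound⁻ (monotone-bound ê monotone) }
  where
  open EndsAt E
  open Insertion e (fromℕ n) m

insertAt-surjective : (e : Vec ℕ (suc n)) (p : Fin (suc n)) →
  ∃[ e′ ] insertAt e′ p (lookup e p) ≡ e
insertAt-surjective e p = removeAt e p , insertAt-removeAt e p

-- Deleting the last entry is the bijection; `m ≤ n` makes `m` admissible at the last position when
-- it is appended again.
endsAt-count : m ≤ n → HasCount (UpTo {n} m) N → HasCount (EndsAt {n} m) N
endsAt-count {m = m} {n = n} m≤n = HasCount-transport
  (λ e ê → insertAt e (fromℕ n) m ≡ ê)
  (λ U → _ , endsAt⁺ m≤n U , refl)
  onto
  (λ eq eq′ → trans (sym eq) eq′)
  (λ _ _ eq eq′ → proj₁ (insertAt-injective (fromℕ n) (trans eq (sym eq′))))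
  where
  onto : ∀ {ê} → EndsAt m ê → ∃[ e ] UpTo m e × insertAt e (fromℕ n) m ≡ ê
  onto {ê} E with e , eq ← insertAt-surjective ê (fromℕ n) rewrite EndsAt.last≡ E =
    e , endsAt⁻ (subst (EndsAt m) (sym eq) E) , eq

upTo-suc : (e : Vec ℕ (suc n)) → (EndsAt (suc m) e ⊎ UpTo m e) ⇔ UpTo (suc m) e
upTo-suc {n = n} {m = m} e = mk⇔
  [ (λ E → let open EndsAt E in record
      { inversion = inversion ; monotone = monotone
      ; bound = λ i → subst (lookup e i ≤_) last≡ (monotone-bound e monotone i) })
  , (λ U → let open UpTo U in record
      { inversion = inversion ; monotone = monotone ; bound = m≤n⇒m≤1+n ∘ bound }) ]′
  split
  where
  split : UpTo (suc m) e → EndsAt (suc m) e ⊎ UpTo m e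
  split U with m≤n⇒m<n∨m≡n (UpTo.bound U (fromℕ n))
  ... | inj₂ last≡ = inj₁ (record
        { inversion = UpTo.inversion U ; monotone = UpTo.monotone U ; last≡ = last≡ })
  ... | inj₁ last< = inj₂ (record
        { inversion = UpTo.inversion U ; monotone = UpTo.monotone U
        ; bound = λ i → ≤-trans (monotone-bound e (UpTo.monotone U) i) (m<1+n⇒m≤n last<) })

upTo-0 : (e : Vec ℕ (suc n)) → EndsAt 0 e ⇔ UpTo 0 e
upTo-0 {n = n} e = mk⇔
  (λ E → let open EndsAt E in record
      { inversion = inversion ; monotone = monotone
      ; bound = λ i → subst (lookup e i ≤_) last≡ (monotone-bound e monotone i) })
  (λ U → let open UpTo U in record
      { inversion = inversion ; monotone = monotone ; last≡ = n≤0⇒n≡0 (bound (fromℕ n)) })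

upTo-length : (e : Vec ℕ (suc n)) → UpTo n e ⇔ UpTo (suc n) e
upTo-length {n = n} e = mk⇔
  (λ U → let open UpTo U in record
      { inversion = inversion ; monotone = monotone ; bound = m≤n⇒m≤1+n ∘ bound })
  (λ U → let open UpTo U in record
      { inversion = inversion ; monotone = monotone
      ; bound = λ i → ≤-trans (inversion i) (Fin.toℕ≤pred[n] i) })

-- These are the ballot numbers C(n+m, m) - C(n+m, m-1), with the subtraction moved to the left
-- side. Distinguishing whether the last entry attains the bound gives their recurrence; a bound
-- equal to the length is never attained.
upTo-count : ∀ n m → m ≤ n →
  ∃[ N ] HasCount (UpTo {n} m) N × N + choose 1 (n + m) m ≡ choose 0 (n + m) m
upTo-count zero    zero    _ = 1 ,
  HasCount-singleton [] (λ { [] → mk⇔ (λ _ → refl)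
    (λ _ → record { inversion = λ () ; monotone = λ { {()} } ; bound = λ () }) }) ,
  refl
upTo-count (suc n) zero    _ with N , count , eq ← upTo-count n zero z≤n =
  N , HasCount-cong upTo-0 (endsAt-count z≤n count) ,
  trans eq (trans (nC0≡1 (n + 0)) (sym (nC0≡1 (suc n + 0))))
upTo-count (suc n) (suc m) (s≤s m≤n)
  with M , countM , eqM ← upTo-count (suc n) m (m≤n⇒m≤1+n m≤n)
  with m≤n⇒m<n∨m≡n m≤n
... | inj₂ refl = M , HasCount-cong upTo-length countM , (begin
  M + choose 0 (suc n + suc n) n
    ≡⟨ cong (λ a → M + choose 0 a n) (+-suc (suc n) n) ⟩
  M + choose 0 (suc (suc n + n)) n
    ≡⟨ cong (λ x → M + x) (choose-pascal 0 (suc n + n) n) ⟩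
  M + (choose 0 (suc n + n) n + choose 1 (suc n + n) n)
    ≡⟨ cong (λ x → M + x) (+-comm (choose 0 (suc n + n) n) _) ⟩
  M + (choose 1 (suc n + n) n + choose 0 (suc n + n) n)
    ≡⟨ +-assoc M _ _ ⟨
  (M + choose 1 (suc n + n) n) + choose 0 (suc n + n) n
    -- The symmetry C(2n+1, n) = C(2n+1, n+1) takes the place of a second recursive count.
    ≡⟨ cong₂ _+_ (trans eqM (sym (C-sym (suc n) n))) refl ⟩
  choose 0 (suc n + n) (suc n) + choose 1 (suc n + n) (suc n)
    ≡⟨ choose-pascal 0 (suc n + n) (suc n) ⟨
  choose 0 (suc (suc n + n)) (suc n)
    ≡⟨ cong (λ a → choose 0 a (suc n)) (+-suc (suc n) n) ⟨
  choose 0 (suc n + suc n) (suc n)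
    ∎)
  where open ≡-Reasoning
... | inj₁ m<n
  with L , countL , eqL ← upTo-count n (suc m) m<n =
  L + M ,
  HasCount-cong upTo-suc (HasCount-⊎ disjoint (endsAt-count m<n countL) countM) , (begin
  (L + M) + choose 0 (suc n + suc m) m
    ≡⟨ cong (λ x → L + M + x) (choose-pascal 0 (n + suc m) m) ⟩
  (L + M) + (choose 0 (n + suc m) m + choose 1 (n + suc m) m)
    ≡⟨ +-interchange L M _ _ ⟩
  (L + choose 1 (n + suc m) (suc m)) + (M + choose 1 (n + suc m) m)
    ≡⟨ cong₂ _+_ eqL (subst (λ a → M + choose 1 a m ≡ choose 0 a m) (sym (+-suc n m)) eqM) ⟩
  choose 0 (n + suc m) (suc m) + choose 1 (n + suc m) (suc m)
    ≡⟨ choose-pascal 0 (n + suc m) (suc m) ⟨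
  choose 0 (suc n + suc m) (suc m)
    ∎)
  where
  open ≡-Reasoning
  disjoint : ∀ e → EndsAt (suc m) e → ¬ UpTo m e
  disjoint e E U = <⇒≱ (n<1+n m) (subst (_≤ m) (EndsAt.last≡ E) (UpTo.bound U (fromℕ n)))

-- Sequences with a descent

Pair : ℕ → Set
Pair n = Vec ℕ n × ℕ

record MonotoneEndsAt (t : ℕ) (x : Pair (suc n)) : Set where
  field
    below : MonotoneBelow t (proj₁ x) (proj₂ x)
    last≡ : lookup (proj₁ x) (fromℕ n) ≡ proj₂ x

-- Pairs with all entries below `m`, so that any position gives the drop. At length `suc n`, the
-- choice `k = n ∸ t` says that the position `m + t` exists.
ShiftedUpTo : ℕ → Pair n → Set
ShiftedUpTo k (e , m) = ∃[ j ] m ≡ suc j × j < k × UpTo j e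

-- The entry at the drop is smaller than `m`, hence is not the last one, and deleting a last entry
-- `m` keeps the pair admissible.
monotoneEndsAt-count : HasCount (λ (x : Pair n) → MonotoneBelow t (proj₁ x) (proj₂ x)) N →
  HasCount (MonotoneEndsAt {n} t) N
monotoneEndsAt-count {n = n} {t = t} = HasCount-transport
  (λ (e , m) (ê , m̂) → insertAt e (fromℕ n) m ≡ ê × m ≡ m̂)
  (λ {x} V → _ , total (proj₁ x) (proj₂ x) V , refl , refl)
  (λ {y} → onto (proj₁ y) (proj₂ y))
  (λ { (refl , refl) (refl , refl) → refl })
  (λ { _ _ (eq , refl) (eq′ , refl) →
       cong (_, _) (proj₁ (insertAt-injective (fromℕ n) (trans eq (sym eq′)))) })
  where
  q<last : (q : Fin n) → toℕ q < toℕ (fromℕ n)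
  q<last q = subst (toℕ q <_) (sym (Fin.toℕ-fromℕ n)) (Fin.toℕ<n q)

  total : ∀ e m → MonotoneBelow t e m → MonotoneEndsAt t (insertAt e (fromℕ n) m , m)
  total e m V = record
    { below = record
      { inversion = inversion-append inversion
          (≤-trans (m≤m+n m t) (≤-trans (≤-reflexive (sym q≡)) (<⇒≤ (Fin.toℕ<n q))))
      ; monotone = monotone-append monotone bound
      ; bound    = bound⁺ bound
      ; q        = punchIn (fromℕ n) q
      ; q≡       = trans (toℕ-punchIn-< (fromℕ n) q (q<last q)) q≡
      ; drop     = subst (_< m) (sym (lookup-off q)) drop }
    ; last≡ = lookup-at }
    where
    open MonotoneBelow V
    open Insertion e (fromℕ n) m

  below⁻ : ∀ e m → MonotoneBelow t (insertAt e (fromℕ n) m) m → MonotoneBelow t e m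
  below⁻ e m V = record
    { inversion = UpTo.inversion U ; monotone = UpTo.monotone U ; bound = UpTo.bound U
    ; q = proj₁ index ; q≡ = proj₁ (proj₂ index) ; drop = proj₂ (proj₂ index) }
    where
    open MonotoneBelow V
    open Insertion e (fromℕ n) m

    U : UpTo m e
    U = endsAt⁻ (record { inversion = inversion ; monotone = monotone ; last≡ = lookup-at })

    index : ∃[ q′ ] toℕ q′ ≡ m + t × lookup e q′ < m
    index with q | q≡ | drop
    ... | q̂ | q̂≡ | drop̂ with punched (fromℕ n) q̂
    ...   | at     = ⊥-elim (<⇒≢ drop̂ lookup-at)
    ...   | off q′ = q′ , trans (sym (toℕ-punchIn-< (fromℕ n) q′ (q<last q′))) q̂≡ ,
                     subst (_< m) (lookup-off q′) drop̂

  onto : ∀ ê m̂ → MonotoneEndsAt t (ê , m̂) →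
    ∃[ x ] MonotoneBelow t (proj₁ x) (proj₂ x) ×
           insertAt (proj₁ x) (fromℕ n) (proj₂ x) ≡ ê × proj₂ x ≡ m̂
  onto ê m̂ E with e , eq ← insertAt-surjective ê (fromℕ n)
    rewrite MonotoneEndsAt.last≡ E =
    (e , m̂) ,
    below⁻ e m̂ (subst (λ v → MonotoneBelow t v m̂) (sym eq) (MonotoneEndsAt.below E)) ,
    eq , refl

monotoneBelow-suc : (x : Pair (suc n)) →
  (MonotoneEndsAt t x ⊎ ShiftedUpTo (n ∸ t) x) ⇔ MonotoneBelow t (proj₁ x) (proj₂ x)
monotoneBelow-suc {n = n} {t = t} x@(e , m) = mk⇔ [ MonotoneEndsAt.below , join ]′ split
  where
  join : ShiftedUpTo (n ∸ t) (e , m) → MonotoneBelow t e m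
  join (j , refl , j<n∸t , U) = record
    { inversion = inversion ; monotone = monotone ; bound = m≤n⇒m≤1+n ∘ bound
    ; q = fromℕ< q<n ; q≡ = Fin.toℕ-fromℕ< q<n ; drop = s≤s (bound _) }
    where
    open UpTo U
    q<n : suc j + t < suc n
    -- Since `j < n ∸ t`, the difference is nonzero and therefore not truncated.
    q<n = s≤s (m≤o∸n⇒m+n≤o (suc j)
      (<⇒≤ (m∸n≢0⇒n<m (λ eq → <⇒≱ j<n∸t (subst (_≤ j) (sym eq) z≤n)))) j<n∸t)

  split : MonotoneBelow t e m → MonotoneEndsAt t x ⊎ ShiftedUpTo (n ∸ t) x
  split V with m≤n⇒m<n∨m≡n (MonotoneBelow.bound V (fromℕ n))
  ... | inj₂ last≡ = inj₁ (record { below = V ; last≡ = last≡ })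
  ... | inj₁ (s≤s {n = j} last≤) = inj₂ (j , refl ,
        m+n≤o⇒m≤o∸n (suc j) (m<1+n⇒m≤n (subst (_< suc n) q≡ (Fin.toℕ<n q))) ,
        record { inversion = inversion ; monotone = monotone
               ; bound = λ i → ≤-trans (monotone-bound e monotone i) last≤ })
    where open MonotoneBelow V

-- Ballot numbers summed over the bounds below `k`: a hockey-stick summation gives C(n+k, k-1) -
-- C(n+k, k-2), again written without subtraction.
shiftedUpTo-count : ∀ n k → k ≤ n →
  ∃[ N ] HasCount (ShiftedUpTo {n} k) N × N + choose 2 (n + k) k ≡ choose 1 (n + k) k
shiftedUpTo-count n zero    _   = 0 , HasCount-∅ (λ _ ()) , refl
shiftedUpTo-count n (suc k) k<n
  with M , countM , eqM ← shiftedUpTo-count n k (<⇒≤ k<n)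
  with L , countL , eqL ← upTo-count n k (<⇒≤ k<n) =
  L + M ,
  HasCount-cong joined (HasCount-⊎ disjoint
    (HasCount-transport (λ e x → (e , suc k) ≡ x)
      (λ {e} U → _ , (refl , U) , refl) (λ { {_ , _} (refl , U) → _ , U , refl })
      (λ { refl refl → refl }) (λ { _ _ refl refl → refl }) countL)
    countM) , (begin
  (L + M) + choose 1 (n + suc k) k
    ≡⟨ cong (λ a → L + M + choose 1 a k) (+-suc n k) ⟩
  (L + M) + choose 1 (suc (n + k)) k
    ≡⟨ cong (λ x → L + M + x) (choose-pascal 1 (n + k) k) ⟩
  (L + M) + (choose 1 (n + k) k + choose 2 (n + k) k)
    ≡⟨ +-interchange L M _ _ ⟩
  (L + choose 1 (n + k) k) + (M + choose 2 (n + k) k)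
    ≡⟨ cong₂ _+_ eqL eqM ⟩
  choose 0 (n + k) k + choose 1 (n + k) k
    ≡⟨ choose-pascal 0 (n + k) k ⟨
  choose 0 (suc (n + k)) k
    ≡⟨ cong (λ a → choose 0 a k) (+-suc n k) ⟨
  choose 0 (n + suc k) k
    ∎)
  where
  open ≡-Reasoning

  Top : Pair n → Set
  Top (e , m) = m ≡ suc k × UpTo k e

  disjoint : ∀ x → Top x → ¬ ShiftedUpTo k x
  disjoint _ (refl , _) (_ , refl , k<k , _) = <-irrefl refl k<k

  joined : ∀ x → (Top x ⊎ ShiftedUpTo k x) ⇔ ShiftedUpTo (suc k) x
  joined x = mk⇔
    [ (λ (m≡ , U) → k , m≡ , n<1+n k , U)
    , (λ (j , m≡ , j<k , U) → j , m≡ , m≤n⇒m≤1+n j<k , U) ]′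
    split
    where
    split : ShiftedUpTo (suc k) x → Top x ⊎ ShiftedUpTo k x
    split (j , m≡ , j<1+k , U) with m≤n⇒m<n∨m≡n (m<1+n⇒m≤n j<1+k)
    ... | inj₁ j<k  = inj₂ (j , m≡ , j<k , U)
    ... | inj₂ refl = inj₁ (m≡ , U)

-- For `t < n` the mirrored binomials of `stepCount-choose` match the closed form of
-- `shiftedUpTo-count`; otherwise both step counts vanish. They are the next terms of the two sums
-- in `monotoneBelow-count`.
shiftedUpTo-stepCount : ∀ n t →
  ∃[ N ] HasCount (ShiftedUpTo {suc n} (n ∸ t)) N ×
         N + stepCount (3 + n) (2 + t) ≡ stepCount (2 + n) t
shiftedUpTo-stepCount n t with <-≤-connex t n
... | inj₂ n≤t rewrite m≤n⇒m∸n≡0 n≤t = 0 , HasCount-∅ (λ _ ()) ,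
      trans (stepCount-zero (2 + n) (2 + t) (s≤s (s≤s (s≤s (m≤n⇒m≤1+n n≤t)))))
            (sym (stepCount-zero (1 + n) t (s≤s (s≤s n≤t))))
... | inj₁ t<n with k , refl ← m≤n⇒∃[o]m+o≡n t<n
  rewrite trans (cong (_∸ t) (sym (+-suc t k))) (m+n∸m≡n t (suc k))
  with N , count , eq ← shiftedUpTo-count (2 + t + k) (suc k)
         (s≤s (≤-trans (m≤n+m k t) (n≤1+n _))) =
  N , count ,
  (begin
  N + stepCount (4 + t + k) (2 + t)
    ≡⟨ cong (λ x → N + x) (stepCount-choose (2 + t) k) ⟩
  N + choose 1 (3 + t + k + k) k
    ≡⟨ cong (λ a → N + choose 1 a k) (+-suc (2 + t + k) k) ⟨
  N + choose 2 (2 + t + k + suc k) (suc k)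
    ≡⟨ eq ⟩
  choose 1 (2 + t + k + suc k) (suc k)
    ≡⟨ cong (λ a → choose 1 (a + suc k) (suc k)) (+-suc (1 + t) k) ⟨
  choose 1 (1 + t + suc k + suc k) (suc k)
    ≡⟨ stepCount-choose t (suc k) ⟨
  stepCount (2 + t + suc k) t
    ≡⟨ cong (λ ℓ → stepCount ℓ t) (+-suc (2 + t) k) ⟩
  stepCount (3 + t + k) t
    ∎)
  where open ≡-Reasoning

-- A pair either ends in `m`, and then comes from a shorter pair, or is a shifted one. The added
-- `descentCount (2 + n) (2 + t)` is the number of insertions into sequences with a descent, so the
-- equation closes the induction in `descending-count`.
monotoneBelow-count : ∀ n t →
  ∃[ N ] HasCount (λ (x : Pair n) → MonotoneBelow t (proj₁ x) (proj₂ x)) N ×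
         N + descentCount (2 + n) (2 + t) ≡ descentCount (1 + n) t
monotoneBelow-count zero    t = 0 , HasCount-∅ (λ _ V → Fin.¬Fin0 (MonotoneBelow.q V)) , refl
monotoneBelow-count (suc n) t
  with M , countM , eqM ← monotoneBelow-count n t
  with L , countL , eqL ← shiftedUpTo-stepCount n t =
  M + L ,
  HasCount-cong monotoneBelow-suc
    (HasCount-⊎ disjoint (monotoneEndsAt-count countM) countL) ,
  trans (+-interchange M L _ _) (cong₂ _+_ eqM eqL)
  where
  disjoint : ∀ x → MonotoneEndsAt t x → ¬ ShiftedUpTo (n ∸ t) x
  disjoint _ E (j , refl , _ , U) =
    <⇒≱ (n<1+n j) (subst (_≤ j) (MonotoneEndsAt.last≡ E) (UpTo.bound U (fromℕ n)))

DescendingFrom : ℕ → Vec ℕ n → Set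
DescendingFrom t e = ∃[ s ] t ≤ s × Descending s e

rank<n : {e : Vec ℕ n} → Descending t e → t < n
rank<n {t = t} {e = e} D =
  ≤-<-trans (≤-trans (m≤n+m t (lookup e p)) (≤-reflexive (sym height))) (Fin.toℕ<n p)
  where open Descending D

module _ {n : ℕ} (count : ∀ t → HasCount (Descending {n} t) (descentCount n t)) where

  -- `count` is the induction hypothesis on the length. The measure `k` drives a downward induction
  -- on `t`, starting from `n ≤ t`, which no rank reaches; each step adds the sequences of rank
  -- exactly `t`.
  descendingFrom-count : ∀ k t → n ≤ t + k →
    HasCount (DescendingFrom {n} t) (descentCount (1 + n) (1 + t))
  descendingFrom-count zero t n≤t
    rewrite +-identityʳ t | descentCount-zero (1 + n) (1 + t) (s≤s (m≤n⇒m≤o+n 2 n≤t)) =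
    HasCount-∅ (λ _ (s , t≤s , D) → <⇒≱ (rank<n D) (≤-trans n≤t t≤s))
  descendingFrom-count (suc k) t n≤t+k =
    subst (HasCount _) (sym (descentCount-pascal n t))
      (HasCount-cong joined (HasCount-⊎ disjoint (count t)
        (descendingFrom-count k (suc t) (subst (n ≤_) (+-suc t k) n≤t+k))))
    where
    disjoint : ∀ e → Descending t e → ¬ DescendingFrom (suc t) e
    disjoint e D (s , t<s , D′) = <⇒≢ t<s (descending-rank-unique D D′)

    joined : ∀ e → (Descending t e ⊎ DescendingFrom (suc t) e) ⇔ DescendingFrom t e
    joined e = mk⇔
      [ (λ D → t , ≤-refl , D) , (λ (s , t<s , D) → s , <⇒≤ t<s , D) ]′
      (λ (s , t≤s , D) → split s t≤s D)
      where
      split : ∀ s → t ≤ s → Descending s e → Descending t e ⊎ DescendingFrom (suc t) e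
      split s t≤s D with m≤n⇒m<n∨m≡n t≤s
      ... | inj₁ t<s  = inj₂ (s , t<s , D)
      ... | inj₂ refl = inj₁ D

  -- For `m` just above the maximum, the remaining condition is that the rank be at least `t`. A
  -- larger `m` is lowered by one while `t` is raised by one, which leaves the sum `m + t` and its
  -- bound unchanged.
  descendingBelow-count : ∀ k t → n ≤ t + k →
    HasCount (λ (x : Pair n) → DescendingBelow t (proj₁ x) (proj₂ x))
             (descentCount (2 + n) (2 + t))
  descendingBelow-count zero t n≤t
    rewrite +-identityʳ t | descentCount-zero (2 + n) (2 + t) (s≤s (s≤s (m≤n⇒m≤o+n 2 n≤t))) =
    HasCount-∅ (λ (e , m) (s , D , max<m , m+t≤) →
      <⇒≱ (rank<n D) (≤-trans n≤t
        (+-cancelˡ-≤ (suc (maxEntry e)) t s (≤-trans (+-monoˡ-≤ t max<m) m+t≤))))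
  descendingBelow-count (suc k) t n≤t+k =
    subst (HasCount _) (sym (descentCount-pascal (suc n) (suc t)))
      (HasCount-cong joined (HasCount-⊎ disjoint
        (HasCount-transport (λ e x → (e , suc (maxEntry e)) ≡ x)
          (λ F → _ , (refl , F) , refl) (λ { {_ , _} (refl , F) → _ , F , refl })
          (λ { refl refl → refl }) (λ { _ _ refl refl → refl })
          (descendingFrom-count (suc k) t n≤t+k))
        (HasCount-transport {Q = Higher}
          (λ (e , m) x → (e , suc m) ≡ x)
          (λ B → _ , B , refl) (λ { {_ , suc m} B → _ , B , refl })
          (λ { refl refl → refl }) (λ { _ _ refl refl → refl })
          (descendingBelow-count k (suc t) (subst (n ≤_) (+-suc t k) n≤t+k)))))
    where
    Lowest : Pair n → Set
    Lowest (e , m) = m ≡ suc (maxEntry e) × DescendingFrom t e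

    Higher : Pair n → Set
    Higher (e , zero)  = ⊥
    Higher (e , suc m) = DescendingBelow (suc t) e m

    disjoint : ∀ x → Lowest x → ¬ Higher x
    disjoint (e , suc m) (refl , _) (_ , _ , max<m , _) = <-irrefl refl max<m

    joined : ∀ x → (Lowest x ⊎ Higher x) ⇔ DescendingBelow t (proj₁ x) (proj₂ x)
    joined (e , m) = mk⇔ [ lowest , higher m ]′ (split m)
      where
      lowest : Lowest (e , m) → DescendingBelow t e m
      lowest (refl , s , t≤s , D) =
        s , D , n<1+n _ , s≤s (+-monoʳ-≤ (maxEntry e) t≤s)

      higher : ∀ m → Higher (e , m) → DescendingBelow t e m
      higher (suc m) (s , D , max<m , m+t≤) =
        s , D , m≤n⇒m≤1+n max<m , subst (_≤ suc (maxEntry e + s)) (+-suc m t) m+t≤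

      split : ∀ m → DescendingBelow t e m → Lowest (e , m) ⊎ Higher (e , m)
      split (suc m) (s , D , max<1+m , m+t≤) with m≤n⇒m<n∨m≡n (m<1+n⇒m≤n max<1+m)
      ... | inj₁ max<m = inj₂ (s , D , max<m , subst (_≤ suc (maxEntry e + s)) (sym (+-suc m t)) m+t≤)
      ... | inj₂ refl  = inj₁ (refl , s , +-cancelˡ-≤ (suc m) t s m+t≤ , D)

descending-count : ∀ n t → HasCount (Descending {n} t) (descentCount n t)
descending-count zero    t = HasCount-∅ (λ _ D → Fin.¬Fin0 (Descending.p D))
descending-count (suc n) t with monotoneBelow-count n t
... | M , countM , eqM = subst (HasCount _) eqM
  (HasCount-transport (InsertedAs t)
    removed⇒descending descending⇒removed insertedAs-functional insertedAs-injective
    (HasCount-⊎ disjoint countM (descendingBelow-count (descending-count n) n t (m≤n+m n t))))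
  where
  disjoint : ∀ x → MonotoneBelow t (proj₁ x) (proj₂ x) →
    ¬ DescendingBelow t (proj₁ x) (proj₂ x)
  disjoint x V (s , D , _) = monotone⇒¬peak {e = proj₁ x} (MonotoneBelow.monotone V) (Descending.peak D)

-- The formula

-- The 1 from the 1-based `fdes` cancels the 1 in `rank`, so the integer equation becomes one
-- between natural numbers without subtraction.
rank-⇔ : ∀ {p} (e : Vec ℕ n) → fdes e ≡ suc p → rank e ≡ + t ⇔ p ≡ maxEntry e + t
rank-⇔ {t = t} {p = p} e fdes≡ rewrite fdes≡ = mk⇔
  (λ eq → ℤ.+-injective (trans (isolate (+ p) (+ maxEntry e)) (cong (λ z → + maxEntry e ℤ.+ z) eq)))
  (λ { refl → cancel (+ maxEntry e) (+ t) })
  where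
  isolate : ∀ x m → x ≡ m ℤ.+ (+ 1 ℤ.+ x - m - + 1)
  isolate = ℤ-Solver.solve-∀

  cancel : ∀ m t → + 1 ℤ.+ (m ℤ.+ t) - m - + 1 ≡ t
  cancel = ℤ-Solver.solve-∀

-- A weakly increasing sequence of length n + 1 has `fdes` n + 1 and its maximum at the end, so rank
-- `t` means that it ends in n - t.
avoidingOfRank-⇔ : t ≤ n → (e : Vec ℕ (suc n)) →
  (EndsAt (n ∸ t) e ⊎ Descending t e) ⇔ AvoidingOfRank (suc n) t e
avoidingOfRank-⇔ {t = t} {n = n} t≤n e = mk⇔ [ weaklyIncreasing , descending ]′ split
  where
  avoiding : IsInversionSequence e → Good e → rank e ≡ + t → AvoidingOfRank (suc n) t e
  avoiding inv good rank≡ = inv , good⇒avoids-102 e good , good⇒avoids-110 e good , rank≡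

  max-last : Monotone e → maxEntry e ≡ lookup e (fromℕ n)
  max-last mono = maxEntry≡ e (fromℕ n) (monotone-bound e mono)

  weaklyIncreasing : EndsAt (n ∸ t) e → AvoidingOfRank (suc n) t e
  weaklyIncreasing E = avoiding inversion (monotone⇒good {e = e} monotone)
    (from (rank-⇔ e (fdes-monotone e monotone))
      (trans (sym (m∸n+n≡m t≤n)) (cong (_+ t) (sym (trans (max-last monotone) last≡)))))
    where open EndsAt E

  descending : Descending t e → AvoidingOfRank (suc n) t e
  descending D = avoiding inversion good (from (rank-⇔ e (fdes-peak e peak)) height′)
    where open Descending D

  split : AvoidingOfRank (suc n) t e → EndsAt (n ∸ t) e ⊎ Descending t e
  split (inv , ¬102 , ¬110 , rank≡) with firstDescent e
  ... | inj₁ mono = inj₁ (record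
    { inversion = inv ; monotone = mono
    ; last≡ = trans (sym (max-last mono)) (trans (sym (m+n∸n≡m _ t))
        (cong (_∸ t) (sym (to (rank-⇔ e (fdes-monotone e mono)) rank≡)))) })
  ... | inj₂ (p , π) = inj₂ (record
    { inversion = inv ; good = good ; p = p ; peak = π
    ; height = trans (to (rank-⇔ e (fdes-peak e π)) rank≡)
        (cong (_+ t) (maxEntry≡ e p (peak-maximal good π))) })
    where
    good : Good e
    good = avoids⇒good e ¬102 ¬110

-- The subtracted sum, indexed by j = n - t - i: its terms are C(t+2j, j) for j < m, where m = n - t
-- - 1.
binomialSum : ℕ → ℕ → ℕ
binomialSum t zero    = 0
binomialSum t (suc m) = (t + m + m) C m + binomialSum t m

-- The list starts at the largest lower index, so its `j`-th term has the lower index `i` with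
-- `suc (j + i) ≡ m`. A general `g` lets the induction shift the list.
sum-applyUpTo : ∀ t m (F g : ℕ → ℕ) →
  (∀ j i → suc (j + i) ≡ m → F (g j) ≡ (t + i + i) C i) →
  sum (map F (applyUpTo g m)) ≡ binomialSum t m
sum-applyUpTo t zero    F g _     = refl
sum-applyUpTo t (suc m) F g terms = cong₂ _+_ (terms 0 m refl)
  (sum-applyUpTo t m F (λ j → g (suc j)) (λ j i eq → terms (suc j) i (cong suc eq)))

-- With a = t + 2m, passing to m + 1 adds C(a+1, m-1) and C(a, m) to C(a, m-1); applying Pascal's
-- rule twice yields C(a+2, m).
descentCount-binomialSum : ∀ t m →
  descentCount (suc (t + m)) t + binomialSum t m ≡ choose 1 (t + m + m) m
descentCount-binomialSum t zero    =
  trans (+-identityʳ _) (descentCount-zero (suc (t + 0)) t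
    (s≤s (≤-trans (≤-reflexive (+-identityʳ t)) (n≤1+n t))))
descentCount-binomialSum t (suc m) = begin
  descentCount (suc (t + suc m)) t + (a C m + binomialSum t m)
    ≡⟨ cong (λ ℓ → descentCount (suc ℓ) t + (a C m + binomialSum t m)) (+-suc t m) ⟩
  descentCount (suc (t + m)) t + stepCount (2 + t + m) t + (a C m + binomialSum t m)
    ≡⟨ cong (λ s → descentCount (suc (t + m)) t + stepCount (2 + t + m) t + s) (+-comm (a C m) _) ⟩
  descentCount (suc (t + m)) t + stepCount (2 + t + m) t + (binomialSum t m + a C m)
    ≡⟨ +-interchange (descentCount (suc (t + m)) t) _ _ _ ⟩
  (descentCount (suc (t + m)) t + binomialSum t m) + (stepCount (2 + t + m) t + a C m)
    ≡⟨ cong₂ (λ x y → x + (y + a C m)) (descentCount-binomialSum t m) (stepCount-choose t m) ⟩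
  choose 1 a m + (choose 1 (suc a) m + choose 0 a m)
    ≡⟨ rearrange (choose 1 a m) (choose 1 (suc a) m) (choose 0 a m) ⟩
  (choose 0 a m + choose 1 a m) + choose 1 (suc a) m
    ≡⟨ cong (_+ choose 1 (suc a) m) (choose-pascal 0 a m) ⟨
  choose 0 (suc a) m + choose 1 (suc a) m
    ≡⟨ choose-pascal 0 (suc a) m ⟨
  choose 0 (suc (suc a)) m
    ≡⟨ cong (λ b → choose 0 b m) (trans (cong (_+ suc m) (+-suc t m)) (+-suc (suc (t + m)) m)) ⟨
  choose 0 (t + suc m + suc m) m
    ∎
  where
  open ≡-Reasoning
  a : ℕ
  a = t + m + m

  rearrange : ∀ x y z → x + (y + z) ≡ (z + x) + y
  rearrange = solve-∀

m+n≡o⇒o∸m≡n : ∀ m {n o} → m + n ≡ o → o ∸ m ≡ n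
m+n≡o⇒o∸m≡n m {n} refl = m+n∸m≡n m n

sumFromTo-binomialSum : ∀ t m →
  sumFromTo 2 (suc (t + m) ∸ t) (λ i → (2 * suc (t + m) ∸ t ∸ 2 * i) C (suc (t + m) ∸ t ∸ i))
    ≡ binomialSum t m
-- The upper limit becomes `suc m`, so the sum from 2 has exactly `m` terms.
sumFromTo-binomialSum t m rewrite m+n≡o⇒o∸m≡n t (+-suc t m) =
  sum-applyUpTo t m _ (λ k → 2 + k) term
  where
  double : ∀ t j i → t + (2 * (2 + j) + (t + i + i)) ≡ 2 * suc (t + suc (j + i))
  double = solve-∀

  term : ∀ j i → suc (j + i) ≡ m →
    (2 * suc (t + m) ∸ t ∸ 2 * (2 + j)) C (suc m ∸ (2 + j)) ≡ (t + i + i) C i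
  term j i refl = cong₂ _C_
    (trans (cong (_∸ 2 * (2 + j)) (m+n≡o⇒o∸m≡n t (double t j i))) (m+n∸m≡n (2 * (2 + j)) _))
    (m+n∸m≡n j i)

difference : ∀ {x y z} → x + y ≡ z → + x ≡ + z - + y
difference {x} {y} refl = sym (cancel (+ x) (+ y))
  where
  cancel : ∀ x y → x ℤ.+ y - y ≡ x
  cancel = ℤ-Solver.solve-∀

-- The ballot number falls short of C(t+2m, m) by C(t+2m, m-1), and `descentCount` and `binomialSum`
-- together supply exactly this.
avoidingOfRank-count : ∀ t m → ∃[ N ] HasCount (AvoidingOfRank (suc (t + m)) t) N ×
  N + binomialSum t m ≡ (t + m + m) C m
avoidingOfRank-count t m
  with L , count , eq ← upTo-count (t + m) m (m≤n+m m t) =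
  L + descentCount (suc (t + m)) t ,
  HasCount-cong (avoidingOfRank-⇔ (m≤m+n t m))
    (HasCount-⊎ (λ e E D → monotone⇒¬peak {e = e} (EndsAt.monotone E) (Descending.peak D))
      (endsAt-count (m∸n≤m (t + m) t)
        (subst (λ k → HasCount (UpTo {t + m} k) L) (sym (m+n∸m≡n t m)) count))
      (descending-count (suc (t + m)) t)) ,
  trans (+-assoc L _ _) (trans (cong (λ x → L + x) (descentCount-binomialSum t m)) eq)

proposition5p17 : (n t : ℕ) → 2 ≤ n → t ≤ n ∸ 1 →
    ∃[ N ] HasCount (AvoidingOfRank n t) N ×
    + N ≡ + ((2 * n ∸ t ∸ 2) C (n ∸ t ∸ 1)) -
    + sumFromTo 2 (n ∸ t) (λ i → (2 * n ∸ t ∸ 2 * i) C (n ∸ t ∸ i))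
proposition5p17 (suc n) t _ t≤n with m≤n⇒∃[o]m+o≡n t≤n
-- `m` is the lower index n - t - 1 of the first binomial; with the length written as `suc (t + m)`
-- no subtraction truncates.
... | m , refl = count , counted , difference (begin
  count + sumFromTo 2 (suc (t + m) ∸ t) (λ i → (2 * suc (t + m) ∸ t ∸ 2 * i) C (suc (t + m) ∸ t ∸ i))
    ≡⟨ cong (λ x → count + x) (sumFromTo-binomialSum t m) ⟩
  count + binomialSum t m
    ≡⟨ eq ⟩
  (t + m + m) C m
    ≡⟨ cong₂ _C_
         (trans (cong (_∸ 2) (m+n≡o⇒o∸m≡n t (double t m))) (m+n∸m≡n 2 (t + m + m)))
         (cong (_∸ 1) (m+n≡o⇒o∸m≡n t (+-suc t m))) ⟨
  (2 * suc (t + m) ∸ t ∸ 2) C (suc (t + m) ∸ t ∸ 1)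
    ∎)
  where
  open ≡-Reasoning
  count : ℕ
  count = proj₁ (avoidingOfRank-count t m)

  counted : HasCount (AvoidingOfRank (suc (t + m)) t) count
  counted = proj₁ (proj₂ (avoidingOfRank-count t m))

  eq : count + binomialSum t m ≡ (t + m + m) C m
  eq = proj₂ (proj₂ (avoidingOfRank-count t m))

  double : ∀ t m → t + (2 + (t + m + m)) ≡ 2 * suc (t + m)
  double = solve-∀
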